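{- For all integers $n\ge 1$, $c\ge 0$ and $k$, $$\left\langle {n \atop k}\right\rangle_{\!c}=\left\langle {n \atop c(n-1)-k}\right\rangle_{\!c}.$$
   Context: A $c$-rook placement on an $n\times n$ board is a placement of $cn$ rooks on the cells, several rooks being allowed in the same cell, such that every row and every column contains exactly $c$ rooks (equivalently, an $n\times n$ matrix of nonnegative integers with all row and column sums equal to $c$). A drop is a rook lying strictly below the main diagonal, i.e.\ in a cell $(i,j)$ (row $i$, column $j$) with $i>j$, counted with multiplicity. The generalized Eulerian number $\left\langle {n \atop k}\right\rangle_{\!c}$ is the number of $c$-rook placements on the $n\times n$ board with exactly $k$ drops (this is $0$ if $k<0$). -}

module Defs where

open import Algebra.Properties.CommutativeMonoid.Sum using (sum-remove)
open import Data.Bool using (if_then_else_)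
open import Data.Fin using (Fin; zero; suc; _<?_)
open import Data.Fin.Properties using (all?)
open import Data.Integer using (ℤ; +_)
import Data.Integer as ℤ
open import Data.List using (List; []; _∷_; length; filter; upTo; cartesianProductWith)
open import Data.List.Membership.Propositional using (_∈_)
open import Data.List.Membership.Propositional.Properties using (∈-filter⁺; ∈-filter⁻; ∈-upTo⁺; ∈-cartesianProductWith⁺)
open import Data.List.Relation.Unary.All using ([])
open import Data.List.Relation.Unary.AllPairs using ([]; _∷_)
open import Data.List.Relation.Unary.Any using (here)
open import Data.List.Relation.Unary.Unique.Propositional using (Unique)
import Data.List.Relation.Unary.Unique.Propositional.Properties as Unique
open import Data.Nat using (ℕ; zero; suc; s≤s; _≤_; _≟_)
open import Data.Nat.Properties using (+-0-commutativeMonoid; m≤m+n; ≤-trans; ≤-reflexive)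
open import Data.Product using (_×_; _,_; proj₂)
open import Data.Vec using (Vec; []; _∷_; lookup)
open import Data.Vec.Properties using (∷-injective)
open import Function.Bundles using (_⇔_; mk⇔)
open import Level using (Level)
open import Relation.Binary.PropositionalEquality using (_≡_; refl; sym)
open import Relation.Nullary using (Dec; does; _×-dec_)

open import Algebra.Properties.CommutativeMonoid.Sum +-0-commutativeMonoid public using (sum; sum-syntax)

private
  variable
    a : Level
    A : Set a

-- The entry in row i and column j is the number of rooks in the cell (i , j).
Board : ℕ → Set
Board n = Vec (Vec ℕ n) n

rooks : ∀ {n} → Board n → Fin n → Fin n → ℕ
rooks M i j = lookup (lookup M i) j

IsPlacement : (n c : ℕ) → Board n → Set
IsPlacement n c M =
  (∀ i → ∑[ j < n ] rooks M i j ≡ c) × (∀ j → ∑[ i < n ] rooks M i j ≡ c)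

drops : ∀ {n} → Board n → ℕ
drops {n} M = ∑[ i < n ] ∑[ j < n ] (if does (j <? i) then rooks M i j else 0)

HasDrops : (n c : ℕ) → ℤ → Board n → Set
HasDrops n c k M = IsPlacement n c M × + drops M ≡ k

isPlacement? : ∀ n c (M : Board n) → Dec (IsPlacement n c M)
isPlacement? n c M =
  all? (λ i → (∑[ j < n ] rooks M i j) ≟ c) ×-dec
  all? (λ j → (∑[ i < n ] rooks M i j) ≟ c)

hasDrops? : ∀ n c k (M : Board n) → Dec (HasDrops n c k M)
hasDrops? n c k M = isPlacement? n c M ×-dec (+ drops M ℤ.≟ k)

vecsOver : List A → (m : ℕ) → List (Vec A m)
vecsOver xs zero    = [] ∷ []
vecsOver xs (suc m) = cartesianProductWith _∷_ xs (vecsOver xs m)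

-- All boards with at most c rooks in each cell; no cell of a c-rook placement
-- can hold more, so every placement occurs here.
boards : (n c : ℕ) → List (Board n)
boards n c = vecsOver (vecsOver (upTo (suc c)) n) n

placements : (n c : ℕ) → ℤ → List (Board n)
placements n c k = filter (hasDrops? n c k) (boards n c)

eulerian : (n c : ℕ) → ℤ → ℕ
eulerian n c k = length (placements n c k)

-- The two facts ∈-placements and placements-unique show that eulerian n c k
-- is the cardinality of { M : Board n | HasDrops n c k M }.

∈-vecsOver : ∀ {xs : List A} {m} (v : Vec A m) →
             (∀ i → lookup v i ∈ xs) → v ∈ vecsOver xs m
∈-vecsOver []      _ = here refl
∈-vecsOver (x ∷ v) p =
  ∈-cartesianProductWith⁺ _∷_ (p zero) (∈-vecsOver v (λ i → p (suc i)))

vecsOver-unique : ∀ {xs : List A} → Unique xs → ∀ m → Unique (vecsOver xs m)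
vecsOver-unique xs! zero    = [] ∷ []
vecsOver-unique xs! (suc m) =
  Unique.cartesianProductWith⁺ _∷_ ∷-injective xs! (vecsOver-unique xs! m)

term≤sum : ∀ {n} (f : Fin n → ℕ) i → f i ≤ sum f
term≤sum {suc n} f i = ≤-trans (m≤m+n (f i) _)
  (≤-reflexive (sym (sum-remove +-0-commutativeMonoid {i = i} f)))

∈-placements : ∀ {n c k} {M : Board n} → M ∈ placements n c k ⇔ HasDrops n c k M
∈-placements {n} {c} {k} {M} = mk⇔
  (λ M∈ → proj₂ (∈-filter⁻ (hasDrops? n c k) {xs = boards n c} M∈))
  (λ { h@((rows , _) , _) → ∈-filter⁺ (hasDrops? n c k)
    (∈-vecsOver M λ i → ∈-vecsOver (lookup M i) λ j → ∈-upTo⁺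
      (s≤s (≤-trans (term≤sum (rooks M i) j) (≤-reflexive (rows i))))) h })

placements-unique : ∀ n c k → Unique (placements n c k)
placements-unique n c k = Unique.filter⁺ (hasDrops? n c k)
  (vecsOver-unique (vecsOver-unique (Unique.upTo⁺ (suc c)) n) n)

{-# OPTIONS --safe #-}
-- Keep row 0 in place, reverse the order of the remaining rows, and reverse the
-- order of the columns: (i , j) ↦ (− i mod n , n − 1 − j).  This involution
-- preserves row and column sums.  Row 0 contains no cell below the diagonal, and
-- for i ≥ 1 the image of (i , j) is below the diagonal iff n − i > n − 1 − j, that
-- is, iff (i , j) is not.  So the drops of a placement and of its image together
-- count all c (n − 1) rooks outside row 0.
module Submission where

open import Defs
open import Data.Nat using (ℕ; _≥_)
open import Data.Integer using (ℤ; +_; _*_; _-_; 1ℤ)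
open import Relation.Binary.PropositionalEquality using (_≡_)

import Data.Integer.Properties as ℤ
open import Algebra.Definitions using (Involutive)
open import Algebra.Properties.AbelianGroup ℤ.+-0-abelianGroup using (xyx⁻¹≈y; ⁻¹-anti-homo‿-)
open import Algebra.Properties.CommutativeMonoid.Sum using (∑-distrib-+; sum-permute; sum-cong-≗; sum-replicate-zero)
open import Data.Bool using (if_then_else_)
open import Data.Fin using (Fin; zero; suc; opposite; _<?_)
open import Data.Fin.Permutation using (Permutation; permutation; reverse; _⟨$⟩ʳ_)
open import Data.Fin.Properties using (opposite-involutive; opposite-prop; toℕ<n)
open import Data.Integer using (_+_)
open import Data.List using (List; length; map)
open import Data.List.Membership.Propositional using (_∈_)
open import Data.List.Membership.Propositional.Properties using (∈-map⁺; ∈-map⁻)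
open import Data.List.Membership.Propositional.Properties.WithK using (unique∧set⇒bag)
open import Data.List.Properties using (length-map)
open import Data.List.Relation.Binary.Permutation.Propositional.Properties using (↭-length)
open import Data.List.Relation.Binary.BagAndSetEquality using (∼bag⇒↭)
open import Data.List.Relation.Unary.Unique.Propositional using (Unique)
import Data.List.Relation.Unary.Unique.Propositional.Properties as Unique
import Data.Nat as ℕ
import Data.Nat.Properties as ℕ
open import Data.Product using (_,_)
open import Data.Vec using (tabulate; lookup)
open import Data.Vec.Properties using (lookup∘tabulate; tabulate∘lookup; tabulate-cong)
open import Function.Bundles using (mk⇔; module Equivalence)
open import Relation.Binary.PropositionalEquality using (refl; sym; trans; cong; cong₂; subst; subst₂; module ≡-Reasoning)
open import Relation.Nullary using (Dec; ¬_; does; yes; no; contradiction)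

private
  variable
    n m c : ℕ

-- An involution is injective, so `map f xs` has no repetitions. The two membership hypotheses give
-- it the same members as `ys`, and duplicate-free lists with the same members are permutations of
-- each other.
involution⇒length≡ : ∀ {a} {A : Set a} {f : A → A} {xs ys : List A} →
  Involutive _≡_ f → Unique xs → Unique ys →
  (∀ {x} → x ∈ xs → f x ∈ ys) → (∀ {y} → y ∈ ys → f y ∈ xs) →
  length xs ≡ length ys
involution⇒length≡ {f = f} {xs} {ys} inv xs! ys! to from =
  trans (sym (length-map f xs)) (↭-length (∼bag⇒↭ (unique∧set⇒bag (Unique.map⁺ inj xs!) ys!
    λ {z} → mk⇔ (λ z∈ → let x , x∈ , z≡ = ∈-map⁻ f z∈ in subst (_∈ ys) (sym z≡) (to x∈))
                (λ z∈ → subst (_∈ map f xs) (inv z) (∈-map⁺ f (from z∈))))))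
  where
  inj : ∀ {x y} → f x ≡ f y → x ≡ y
  inj {x} {y} eq = trans (sym (inv x)) (trans (cong f eq) (inv y))

negate : Fin n → Fin n
negate zero    = zero
negate (suc i) = suc (opposite i)

negate-involutive : Involutive _≡_ (negate {n})
negate-involutive zero    = refl
negate-involutive (suc i) = cong suc (opposite-involutive i)

negation : Permutation n n
negation = permutation negate negate negate-involutive negate-involutive

sum-cong : {f g : Fin n → ℕ} → (∀ i → f i ≡ g i) → sum f ≡ sum g
sum-cong = sum-cong-≗ ℕ.+-0-commutativeMonoid

sum-reindex : (f : Fin n → ℕ) (π : Permutation n n) → sum f ≡ sum (λ i → f (π ⟨$⟩ʳ i))
sum-reindex = sum-permute ℕ.+-0-commutativeMonoid

sum-const : ∀ n c → ∑[ i < n ] c ≡ n ℕ.* c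
sum-const ℕ.zero    c = refl
sum-const (ℕ.suc n) c = cong (c ℕ.+_) (sum-const n c)

reflect : Board n → Board n
reflect M = tabulate λ i → tabulate λ j → rooks M (negate i) (opposite j)

rooks-tabulate : (f : Fin n → Fin n → ℕ) (i j : Fin n) →
  rooks (tabulate λ i → tabulate (f i)) i j ≡ f i j
rooks-tabulate f i j = trans
  (cong (λ r → lookup r j) (lookup∘tabulate (λ i → tabulate (f i)) i))
  (lookup∘tabulate (f i) j)

rooks-reflect : (M : Board n) (i j : Fin n) → rooks (reflect M) i j ≡ rooks M (negate i) (opposite j)
rooks-reflect M = rooks-tabulate λ i j → rooks M (negate i) (opposite j)

tabulate-rooks : (M : Board n) → (tabulate λ i → tabulate (rooks M i)) ≡ M
tabulate-rooks M = trans (tabulate-cong (λ i → tabulate∘lookup (lookup M i))) (tabulate∘lookup M)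

reflect-involutive : Involutive _≡_ (reflect {n})
reflect-involutive M = trans
  (tabulate-cong λ i → tabulate-cong λ j → trans
    (rooks-reflect M (negate i) (opposite j))
    (cong₂ (rooks M) (negate-involutive i) (opposite-involutive j)))
  (tabulate-rooks M)

-- Row `i` of the reflection is row `negate i` read backwards, and column `j` is column `opposite j`
-- with its entries permuted by `negation`; a sum ignores the order of its terms.
reflect-isPlacement : (M : Board n) → IsPlacement n c M → IsPlacement n c (reflect M)
reflect-isPlacement M (rows , cols) =
  (λ i → trans (sum-cong (rooks-reflect M i))
    (trans (sym (sum-reindex (rooks M (negate i)) reverse)) (rows (negate i)))) ,
  (λ j → trans (sum-cong (λ i → rooks-reflect M i j))
    (trans (sym (sum-reindex (λ i → rooks M i (opposite j)) negation)) (cols (opposite j))))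

below : Fin n → Fin n → ℕ → ℕ
below i j x = if does (j <? i) then x else 0

if-complement : ∀ {p q} {P : Set p} {Q : Set q} (P? : Dec P) (Q? : Dec Q) →
  (P → ¬ Q) → (¬ P → Q) → ∀ x →
  (if does P? then x else 0) ℕ.+ (if does Q? then x else 0) ≡ x
if-complement (yes _)  (no _)   _    _    x = ℕ.+-identityʳ x
if-complement (no _)   (yes _)  _    _    x = refl
if-complement (yes p)  (yes q)  P⇒¬Q _    x = contradiction q (P⇒¬Q p)
if-complement (no ¬p)  (no ¬q)  _    ¬P⇒Q x = contradiction (¬P⇒Q ¬p) ¬q

-- With `a` and `b` the values of `i` and `j`, the first test is `b < a + 1`. The second is
-- `m ∸ b < 1 + (m ∸ (a + 1))`, which amounts to `a + 1 ≤ b`.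
below-complement : (i : Fin m) (j : Fin (ℕ.suc m)) (x : ℕ) →
  below (suc i) j x ℕ.+ below (negate (suc i)) (opposite j) x ≡ x
below-complement {m} i j = if-complement (j <? suc i) (opposite j <? negate (suc i))
  -- Truncated subtraction from `m` reverses a strict inequality only while the larger subtrahend is
  -- at most `m`; here that is `a + 1 ≤ m`, given by `toℕ<n i`.
  (λ { j<1+i (ℕ.s≤s j′≤i′) → ℕ.<⇒≱ (ℕ.∸-monoʳ-< j<1+i (toℕ<n i))
    (subst₂ ℕ._≤_ (opposite-prop j) (opposite-prop i) j′≤i′) })
  (λ j≮1+i → ℕ.s≤s (subst₂ ℕ._≤_ (sym (opposite-prop j)) (sym (opposite-prop i))
    (ℕ.∸-monoʳ-≤ m (ℕ.≮⇒≥ j≮1+i))))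

drops-tail : (M : Board (ℕ.suc m)) →
  drops M ≡ ∑[ i < m ] ∑[ j < ℕ.suc m ] below (suc i) j (rooks M (suc i) j)
drops-tail {m} M = cong
  (ℕ._+ (∑[ i < m ] ∑[ j < ℕ.suc m ] below (suc i) j (rooks M (suc i) j)))
  -- In row 0 every test `j <? zero` computes to false. The zero from column 0 is absorbed by
  -- evaluation, which leaves a sum of `m` zeros.
  (sum-replicate-zero ℕ.+-0-commutativeMonoid m)

-- Moves the reflection from the rooks to the tests, so that this sum and the one in `drops-tail`
-- weigh the same entries of `M` and can be added cell by cell.
drops-reflect-tail : (M : Board (ℕ.suc m)) →
  drops (reflect M) ≡
    ∑[ i < m ] ∑[ j < ℕ.suc m ] below (negate (suc i)) (opposite j) (rooks M (suc i) j)
drops-reflect-tail {m} M = begin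
  drops (reflect M)
    ≡⟨ drops-tail (reflect M) ⟩
  ∑[ i < m ] ∑[ j < ℕ.suc m ] below (suc i) j (rooks (reflect M) (suc i) j)
    -- Reversing the tail indices is the same as applying `negate` to the rows, since
    -- `negate (suc i)` unfolds to `suc (opposite i)`.
    ≡⟨ sum-reindex (λ i → sum (f (suc i))) reverse ⟩
  ∑[ i < m ] ∑[ j < ℕ.suc m ] below (negate (suc i)) j (rooks (reflect M) (negate (suc i)) j)
    ≡⟨ sum-cong {n = m} (λ i → sum-reindex (f (negate (suc i))) reverse) ⟩
  ∑[ i < m ] ∑[ j < ℕ.suc m ]
    below (negate (suc i)) (opposite j) (rooks (reflect M) (negate (suc i)) (opposite j))
    ≡⟨ sum-cong {n = m} (λ i → sum-cong λ j → cong (below (negate (suc i)) (opposite j))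
         (trans (rooks-reflect M (negate (suc i)) (opposite j))
           (cong₂ (rooks M) (negate-involutive (suc i)) (opposite-involutive j)))) ⟩
  ∑[ i < m ] ∑[ j < ℕ.suc m ] below (negate (suc i)) (opposite j) (rooks M (suc i) j) ∎
  where
  open ≡-Reasoning
  f : Fin (ℕ.suc m) → Fin (ℕ.suc m) → ℕ
  f i j = below i j (rooks (reflect M) i j)

drops+drops-reflect : (M : Board (ℕ.suc m)) → IsPlacement (ℕ.suc m) c M →
  drops M ℕ.+ drops (reflect M) ≡ c ℕ.* m
drops+drops-reflect {m} {c} M (rows , _) = begin
  drops M ℕ.+ drops (reflect M)
    ≡⟨ cong₂ ℕ._+_ (drops-tail M) (drops-reflect-tail M) ⟩
  sum (λ i → sum (f i)) ℕ.+ sum (λ i → sum (g i))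
    ≡⟨ ∑-distrib-+ ℕ.+-0-commutativeMonoid (λ i → sum (f i)) (λ i → sum (g i)) ⟨
  ∑[ i < m ] (sum (f i) ℕ.+ sum (g i))
    ≡⟨ sum-cong (λ i → ∑-distrib-+ ℕ.+-0-commutativeMonoid (f i) (g i)) ⟨
  ∑[ i < m ] ∑[ j < ℕ.suc m ] (f i j ℕ.+ g i j)
    ≡⟨ sum-cong (λ i → sum-cong λ j → below-complement i j (rooks M (suc i) j)) ⟩
  ∑[ i < m ] ∑[ j < ℕ.suc m ] rooks M (suc i) j
    ≡⟨ sum-cong (λ i → rows (suc i)) ⟩
  ∑[ i < m ] c
    ≡⟨ sum-const m c ⟩
  m ℕ.* c
    ≡⟨ ℕ.*-comm m c ⟩
  c ℕ.* m ∎
  where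
  open ≡-Reasoning
  f g : Fin m → Fin (ℕ.suc m) → ℕ
  f i j = below (suc i) j (rooks M (suc i) j)
  g i j = below (negate (suc i)) (opposite j) (rooks M (suc i) j)

m+n≡o⇒+n≡+o-+m : ∀ m {n o} → m ℕ.+ n ≡ o → + n ≡ + o - + m
m+n≡o⇒+n≡+o-+m m {n} refl = sym (xyx⁻¹≈y (+ m) (+ n))

x-[x-y]≡y : ∀ x y → x - (x - y) ≡ y
x-[x-y]≡y x y = begin
  x - (x - y)  ≡⟨ cong (λ z → x + z) (⁻¹-anti-homo‿- x y) ⟩
  x + (y - x)  ≡⟨ ℤ.+-assoc x y _ ⟨
  x + y - x    ≡⟨ xyx⁻¹≈y x y ⟩
  y            ∎
  where open ≡-Reasoning

reflect-hasDrops : ∀ {k} (M : Board (ℕ.suc m)) → HasDrops (ℕ.suc m) c k M →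
  HasDrops (ℕ.suc m) c (+ c * (+ ℕ.suc m - 1ℤ) - k) (reflect M)
reflect-hasDrops {m} {c} M (p , refl) = reflect-isPlacement M p ,
  trans (m+n≡o⇒+n≡+o-+m (drops M) (drops+drops-reflect M p))
    -- The factor `+ ℕ.suc m - 1ℤ` evaluates to `+ m`, so it only remains to split the cast of the
    -- product `c ℕ.* m`.
    (cong (_- + drops M) (ℤ.pos-* c m))

theorem4p1 : (n c : ℕ) (k : ℤ) → n ≥ 1 → eulerian n c k ≡ eulerian n c (+ c * (+ n - 1ℤ) - k)
theorem4p1 n@(ℕ.suc m) c k _ = involution⇒length≡ {f = reflect} reflect-involutive
  (placements-unique n c k) (placements-unique n c (K - k)) reflect-∈
  -- The way back is `reflect-∈` again, at `K - k`: it lands in `K - (K - k)`, which is `k`.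
  (λ {M} M∈ → subst (λ l → reflect M ∈ placements n c l) (x-[x-y]≡y K k) (reflect-∈ M∈))
  where
  open Equivalence
  K = + c * (+ n - 1ℤ)
  reflect-∈ : ∀ {l M} → M ∈ placements n c l → reflect M ∈ placements n c (K - l)
  reflect-∈ {M = M} M∈ = from ∈-placements (reflect-hasDrops M (to ∈-placements M∈))
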